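{- Let $\mathcal{AF}=\langle Args, Att\rangle$ be an abstract argumentation framework with $Args$ finite, let $a\in Args$, let $T$ be the dispute tree induced by $a$, and let $IS_T$ be the interpreted system associated with $T$. Let $p,o,e$ be strategy variables for the agents $Pro$, $Opp$, $Env$ respectively. Then the proponent has an admissible winning strategy $\sigma$ in $T$ (applied at the root $a$) if and only if $$IS_T\models \exists p\,\forall e\,\big(\phi_1\wedge\phi_2\big),$$ where $$\phi_1=\forall o\; G\Big(\bigwedge_{i\in Args}\neg G(Opp_i)\Big),\qquad \phi_2=\bigwedge_{i\in Args}\Big(\exists o\,F(Pro_i)\Rightarrow \forall o\,G(\neg Opp_i)\Big).$$
   Context: **Argumentation frameworks and dispute trees.** An abstract argumentation framework is a pair $\langle Args, Att\rangle$ with $Args$ a set of arguments and $Att\subseteq Args\times Args$; $(x,y)\in Att$ means $x$ attacks $y$. The dispute tree $T$ induced by $a\in Args$ is the (possibly infinite) tree whose nodes carry arguments, such that: the root carries $a$ and is labelled P (played by the proponent); the children of a node carrying $y$ carry exactly the arguments $x$ with $(x,y)\in Att$ (one child for each such $x$); labels alternate along branches between P (proponent) and O (opponent), indicating who put the argument forward. A strategy is a partial function $\sigma: Args\rightharpoonup Args$ mapping an argument to one of its attackers, if there are any. Applying $\sigma$ from the root $a$ yields the subtree $T_\sigma$ of $T$ with root $a$ in which every node labelled P retains all of its children, and every node labelled O carrying argument $i$ retains at most one child, namely the one carrying $\sigma(i)$ (none if $\sigma(i)$ is undefined). $\sigma$ applied at root $a$ is an *admissible winning strategy* iff every opponent node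 in $T_\sigma$ has exactly one child and no argument is labelled in $T_\sigma$ by both the proponent and the opponent (i.e. no argument is carried both by a P-node and by an O-node of $T_\sigma$). **The interpreted system $IS_T$.** Agents: $Ag=\{Pro,Opp,Env\}$. Local states: $L_{Pro}=Args$; $L_{Opp}=Args\cup\{empty\}$; $L_{Env}$ consists of triples $(turn,last,attacksSeen)$ with $turn\in\{Pro,Opp\}$, $last\in Args$, $attacksSeen\subseteq Att$. A global state is an element of $L_{Pro}\times L_{Opp}\times L_{Env}$. The unique initial state is $s_0=(a, empty,(Opp,a,\emptyset))$. Actions: $Act_{Pro}=Act_{Opp}=\{attack_{xy}\mid (x,y)\in Att\}\cup\{nothing\}$, $Act_{Env}=\{nothing\}$; joint actions are triples in $Act_{Pro}\times Act_{Opp}\times Act_{Env}$. Protocols (enabled actions): for $i\in\{Pro,Opp\}$, when $Env$ is in state $(turn,last,\_)$, $P_i$ equals $\{attack_{x\,last}\mid (x,last)\in Att\}$ if $turn=i$ and this set is nonempty, and $\{nothing\}$ otherwise; $Env$ always has only $nothing$ enabled. Transitions (deterministic, componentwise): if $Env$ is in state $(Pro,y,S)$ and the joint action is $(attack_{xy},nothing,nothing)$, then the local state of $Pro$ becomes $x$, that of $Opp$ is unchanged, and that of $Env$ becomes $(Opp,x,S\cup\{(x,y)\})$; if $Env$ is in state $(Opp,y,S)$ and the joint action is $(nothing,attack_{xy},nothing)$, then the local state of $Opp$ becomes $x$, that of $Pro$ is unchanged, and that of $Env$ becomes $(Pro,x,S\cup\{(x,y)\})$; if all agents do $nothing$, the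 global state is unchanged. Atomic propositions: $Pro_x$, $Opp_x$ for $x\in Args$. At a reachable global state $g$: $Pro_x$ holds iff $Pro$'s local state is $x$ and $Env$'s local state has the form $(Opp,x,\_)$; $Opp_x$ holds iff $Opp$'s local state is $x$ and $Env$'s local state has the form $(Pro,x,\_)$. **Strategy Logic.** A strategy of agent $i\in\{Pro,Opp\}$ is a function $f_i: L_i\times L_{Env}\to Act_i$ choosing an enabled action, $f_i(l_i,l_e)\in P_i(l_i,l_e)$; a strategy of $Env$ is a function $f_{Env}:L_{Env}\to Act_{Env}$. An assignment $\chi$ maps strategy variables to strategies of the corresponding agent; $\chi[x\mapsto f]$ is $\chi$ with $x$ (re)assigned to $f$. When all three variables $p,o,e$ are assigned, the $\chi$-$s$ play is the unique infinite path $\lambda=\lambda[0],\lambda[1],\dots$ with $\lambda[0]=s$ obtained when all agents follow the strategies assigned in $\chi$. Satisfaction $(IS_T,\chi,s)\models\phi$: atoms and Boolean connectives as usual; $(IS_T,\chi,s)\models\exists x\,\phi$ iff $(IS_T,\chi[x\mapsto f],s)\models\phi$ for some strategy $f$ of the agent of $x$; $\forall x$ is $\neg\exists x\neg$; $(IS_T,\chi,s)\models G\phi$ iff $(IS_T,\chi,\lambda[k])\models\phi$ for all $k\ge0$, and $(IS_T,\chi,s)\models F\phi$ iff $(IS_T,\chi,\lambda[k])\models\phi$ for some $k\ge0$, where $\lambda$ is the $\chi$-$s$ play. $IS_T\models\phi$ means $(IS_T,\emptyset,s_0)\models\phi$ with the empty assignment. -}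

module Defs where

open import Data.Nat using (ℕ; zero; suc; _*_)
open import Data.Fin using (Fin; combine; _≟_)
open import Data.Fin.Subset using (Subset; _∈_; _⊆_; _∪_; ⁅_⁆; ⊥)
open import Data.Fin.Subset.Properties using (⊥⊆; x∈p∪q⁻; x∈⁅y⁆⇒x≡y)
open import Data.Maybe using (Maybe; just; nothing)
open import Data.Product using (Σ; Σ-syntax; ∃; ∃-syntax; ∃!; _×_; _,_)
open import Data.Sum using ([_,_])
open import Relation.Binary.PropositionalEquality using (_≡_; sym; subst)
open import Relation.Nullary using (¬_; yes; no)

-- The finite set Args is Fin n; a set of pairs of arguments is a subset
-- of Fin (n * n), the pair (x , y) being encoded as combine x y.
record Framework (n : ℕ) : Set where
  constructor mkFramework
  field
    Att : Subset (n * n)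

  Attacks : Fin n → Fin n → Set
  Attacks x y = combine x y ∈ Att

data Player : Set where
  Pro Opp : Player

module DisputeTree {n : ℕ} (AF : Framework n) (a : Fin n) where
  open Framework AF

  -- The dispute tree T induced by a, given by its nodes, each identified
  -- with the branch leading to it: Node l y is the type of the nodes
  -- labelled l and carrying y.  Membership proofs in a Subset are unique,
  -- so a node carrying y has exactly one child per attacker of y.
  data Node : Player → Fin n → Set where
    root       : Node Pro a
    childOfPro : ∀ {x y} → Node Pro y → Attacks x y → Node Opp x
    childOfOpp : ∀ {x y} → Node Opp y → Attacks x y → Node Pro x

  record TreeStrategy : Set where
    constructor mkTreeStrategy
    field
      move    : Fin n → Maybe (Fin n)
      attacks : ∀ {x i} → move i ≡ just x → Attacks x i

  open TreeStrategy

  -- The nodes of T that belong to the subtree T_σ.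
  data _∈T[_] : ∀ {l y} → Node l y → TreeStrategy → Set where
    root∈ : ∀ {σ} → root ∈T[ σ ]
    pro∈  : ∀ {σ x y} {ν : Node Pro y} → ν ∈T[ σ ] →
            (xy : Attacks x y) → childOfPro ν xy ∈T[ σ ]
    opp∈  : ∀ {σ x i} {ν : Node Opp i} → ν ∈T[ σ ] →
            (xi : Attacks x i) → move σ i ≡ just x → childOfOpp ν xi ∈T[ σ ]

  HasOneChild : ∀ {y} → TreeStrategy → Node Opp y → Set
  HasOneChild {y} σ ν =
    ∃! {A = Σ[ x ∈ Fin n ] Attacks x y} _≡_ λ (_ , xy) → childOfOpp ν xy ∈T[ σ ]

  -- In T_σ, the argument x is carried by some node labelled l.
  Labelled : TreeStrategy → Player → Fin n → Set
  Labelled σ l x = Σ[ ν ∈ Node l x ] ν ∈T[ σ ]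

  record IsAdmissibleWinning (σ : TreeStrategy) : Set where
    field
      opponentAnswered : ∀ {i} (ν : Node Opp i) → ν ∈T[ σ ] → HasOneChild σ ν
      conflictFree     : ∀ x → ¬ (Labelled σ Pro x × Labelled σ Opp x)

data Agent : Set where
  player : Player → Agent
  Env    : Agent

data Var : Set where
  p o e : Var

agent : Var → Agent
agent p = player Pro
agent o = player Opp
agent e = Env

infix  9 ∼_
infixr 6 _∧′_
infixr 5 _⇒′_

data Formula (n : ℕ) : Set where
  pro  : Fin n → Formula n
  opp  : Fin n → Formula n
  ∼_   : Formula n → Formula n
  _∧′_ : Formula n → Formula n → Formula n
  _⇒′_ : Formula n → Formula n → Formula n
  ⋀    : (Fin n → Formula n) → Formula n
  ∃′   : Var → Formula n → Formula n
  G    : Formula n → Formula n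
  F    : Formula n → Formula n

∀′ : ∀ {n} → Var → Formula n → Formula n
∀′ x φ = ∼ ∃′ x (∼ φ)

module InterpretedSystem {n : ℕ} (AF : Framework n) (a : Fin n) where
  open Framework AF

  record EnvState : Set where
    constructor envState
    field
      turn        : Player
      last        : Fin n
      attacksSeen : Subset (n * n)
      .seen⊆Att   : attacksSeen ⊆ Att

  -- In the local states of Opp, nothing stands for the state "empty".
  Local : Agent → Set
  Local (player Pro) = Fin n
  Local (player Opp) = Maybe (Fin n)
  Local Env          = EnvState

  record State : Set where
    constructor ⟪_,_,_⟫
    field
      proLocal : Local (player Pro)
      oppLocal : Local (player Opp)
      envLocal : Local Env

  open State

  s₀ : State
  s₀ = ⟪ a , nothing , envState Opp a ⊥ ⊥⊆ ⟫

  data PlayerAction : Set where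
    attack : (x y : Fin n) → Attacks x y → PlayerAction
    idle   : PlayerAction                  -- the action "nothing"

  data EnvAction : Set where
    idle : EnvAction

  -- Enabled i s c: action c is in P_i when Env is in state s.  The
  -- protocol does not depend on the local state of i itself.
  data Enabled (i : Player) : EnvState → PlayerAction → Set where
    attackEnabled : ∀ {x y S} .{S⊆ : S ⊆ Att} (xy : Attacks x y) →
                    Enabled i (envState i y S S⊆) (attack x y xy)
    idleEnabled   : ∀ {t y S} .{S⊆ : S ⊆ Att} →
                    ¬ (t ≡ i × ∃[ x ] Attacks x y) →
                    Enabled i (envState t y S S⊆) idle

  record PlayerStrategy (i : Player) : Set where
    constructor mkStrategy
    field
      act     : Local (player i) → EnvState → PlayerAction
      enabled : ∀ l s → Enabled i s (act l s)

  Strategy : Agent → Set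
  Strategy (player i) = PlayerStrategy i
  Strategy Env        = EnvState → EnvAction

  insert-⊆ : ∀ {S : Subset (n * n)} {c} → S ⊆ Att → c ∈ Att → (S ∪ ⁅ c ⁆) ⊆ Att
  insert-⊆ {S} {c} S⊆ c∈ z∈ =
    [ S⊆ , (λ z∈c → subst (_∈ Att) (sym (x∈⁅y⁆⇒x≡y c z∈c)) c∈) ]
      (x∈p∪q⁻ S ⁅ c ⁆ z∈)

  -- The second argument is the local state of Env.  The joint actions for
  -- which no transition is prescribed are never enabled; the catch-all
  -- clauses leave the state unchanged on them.
  step : State → EnvState → PlayerAction → PlayerAction → EnvAction → State
  step g (envState Pro y S S⊆) (attack x y′ xy) idle idle with y′ ≟ y
  ... | yes _ = ⟪ x , oppLocal g ,
                  envState Opp x (S ∪ ⁅ combine x y′ ⁆) (insert-⊆ S⊆ xy) ⟫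
  ... | no  _ = g
  step g (envState Opp y S S⊆) idle (attack x y′ xy) idle with y′ ≟ y
  ... | yes _ = ⟪ proLocal g , just x ,
                  envState Pro x (S ∪ ⁅ combine x y′ ⁆) (insert-⊆ S⊆ xy) ⟫
  ... | no  _ = g
  step g _ idle idle idle = g
  step g _ _    _    _    = g

  Assignment : Set
  Assignment = (x : Var) → Maybe (Strategy (agent x))

  ∅ : Assignment
  ∅ _ = nothing

  _[_↦_] : Assignment → (x : Var) → Strategy (agent x) → Assignment
  (χ [ p ↦ f ]) p = just f
  (χ [ o ↦ f ]) o = just f
  (χ [ e ↦ f ]) e = just f
  (χ [ _ ↦ _ ]) y = χ y

  next : PlayerStrategy Pro → PlayerStrategy Opp → Strategy Env → State → State
  next fₚ fₒ fₑ g =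
    step g s (act fₚ (proLocal g) s)
             (act fₒ (oppLocal g) s)
             (fₑ s)
    where
    open PlayerStrategy
    s = envLocal g

  path : (State → State) → State → ℕ → State
  path f s zero    = s
  path f s (suc k) = f (path f s k)

  playOf : Maybe (PlayerStrategy Pro) → Maybe (PlayerStrategy Opp) →
           Maybe (Strategy Env) → State → Maybe (ℕ → State)
  playOf (just fₚ) (just fₒ) (just fₑ) s = just (path (next fₚ fₒ fₑ) s)
  playOf _         _         _         _ = nothing

  play : Assignment → State → Maybe (ℕ → State)
  play χ = playOf (χ p) (χ o) (χ e)

  -- The atoms are interpreted at all states by the condition given for the
  -- reachable ones; plays from s₀ visit reachable states only.
  -- Where χ leaves a variable unassigned there is no χ-s play, and both
  -- G φ and F φ are taken to fail.
  infix 4 _,_⊨_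
  _,_⊨_ : Assignment → State → Formula n → Set
  χ , s ⊨ pro x   = proLocal s ≡ x ×
                    EnvState.turn (envLocal s) ≡ Opp ×
                    EnvState.last (envLocal s) ≡ x
  χ , s ⊨ opp x   = oppLocal s ≡ just x ×
                    EnvState.turn (envLocal s) ≡ Pro ×
                    EnvState.last (envLocal s) ≡ x
  χ , s ⊨ ∼ φ     = ¬ (χ , s ⊨ φ)
  χ , s ⊨ φ ∧′ ψ  = (χ , s ⊨ φ) × (χ , s ⊨ ψ)
  χ , s ⊨ φ ⇒′ ψ  = χ , s ⊨ φ → χ , s ⊨ ψ
  χ , s ⊨ ⋀ φ     = ∀ i → χ , s ⊨ φ i
  χ , s ⊨ ∃′ x φ  = Σ[ f ∈ Strategy (agent x) ] (χ [ x ↦ f ]) , s ⊨ φ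
  χ , s ⊨ G φ     = ∃[ ρ ] play χ s ≡ just ρ × (∀ k → χ , ρ k ⊨ φ)
  χ , s ⊨ F φ     = ∃[ ρ ] play χ s ≡ just ρ × (∃[ k ] χ , ρ k ⊨ φ)

  infix 4 IS⊨_
  IS⊨_ : Formula n → Set
  IS⊨ φ = ∅ , s₀ ⊨ φ

{-# OPTIONS --safe #-}

-- An admissible winning strategy for the dispute about a exists iff a lies in an
-- admissible set: a conflict-free set of arguments that counterattacks each of
-- its attackers.
--
-- From left to right, Pro plays by σ; every play then follows a branch of T_σ, so
-- Pro always has an answer and the atoms Pro_i, Opp_i seen along plays are labels
-- in T_σ.  From right to left, the arguments i for which ∃o F(Pro_i) holds against
-- the given strategy of Pro form an admissible set.  Indeed, if x attacks such an
-- i, Opp can deviate by answering every i with x; the play is unchanged until i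
-- is first put forward, so x is put forward, and Pro answers it by φ₁.
-- Conflict-freeness is then φ₂.  That set need not be decidable, and φ₁ and φ₂
-- are only available doubly negated, but the existence of an admissible set is
-- decidable, hence stable under double negation.
module Submission where

open import Defs
open import Data.Nat using (ℕ; zero; suc)
open import Data.Fin using (Fin; combine; _≟_)
open import Data.Fin.Properties using (all?; any?; sequence)
open import Data.Fin.Subset using (Subset; _∈_)
open import Data.Fin.Subset.Properties using (_∈?_; anySubset?)
open import Data.Maybe using (Maybe; just; nothing)
open import Data.Product using (Σ-syntax; ∃; ∃-syntax; _×_; _,_; proj₁; proj₂)
open import Data.Sum using (_⊎_; inj₁; inj₂)
open import Data.Vec using (tabulate)
open import Data.Vec.Properties using (lookup∘tabulate; lookup⇒[]=; []=⇒lookup)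
open import Data.Vec.Properties.WithK using ([]=-irrelevant)
open import Effect.Monad using (RawMonad)
open import Function using (_∘_)
open import Function.Bundles using (_⇔_; mk⇔)
open import Relation.Binary.PropositionalEquality
  using (_≡_; _≢_; refl; sym; trans; cong; subst)
open import Relation.Nullary using (¬_; Dec; yes; no; does; contradiction)
open import Relation.Nullary.Decidable
  using (_×-dec_; _→-dec_; ¬?; map′; dec-true; decidable-stable; ¬¬-excluded-middle)
open import Relation.Nullary.Negation using (¬¬-Monad)
open import Relation.Unary using (Decidable)

-- Decidability up to double negation, and comprehension on finite sets

private
  variable
    n : ℕ

-- Excluded middle holds doubly negated at each point, and a finite product of doubly negated types
-- is again doubly negated.
¬¬-decidable : (P : Fin n → Set) → ¬ ¬ Decidable P
¬¬-decidable P = sequence (RawMonad.rawApplicative ¬¬-Monad) (λ _ → ¬¬-excluded-middle)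

module _ {P : Fin n → Set} (P? : Decidable P) where

  comprehension : Subset n
  comprehension = tabulate (does ∘ P?)

  comprehension⁺ : ∀ {i} → P i → i ∈ comprehension
  comprehension⁺ {i} Pi =
    lookup⇒[]= i _ (trans (lookup∘tabulate (does ∘ P?) i) (dec-true (P? i) Pi))

  comprehension⁻ : ∀ {i} → i ∈ comprehension → P i
  comprehension⁻ {i} i∈ with P? i | trans (sym (lookup∘tabulate (does ∘ P?) i)) ([]=⇒lookup i∈)
  ... | yes Pi | _ = Pi
  ... | no _   | ()

_≟ᴾ_ : (i j : Player) → Dec (i ≡ j)
Pro ≟ᴾ Pro = yes refl
Pro ≟ᴾ Opp = no λ ()
Opp ≟ᴾ Pro = no λ ()
Opp ≟ᴾ Opp = yes refl

-- Admissible sets and the tree strategies they induce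

module AdmissibleSets (AF : Framework n) (a : Fin n) where
  open Framework AF
  open DisputeTree AF a
  open TreeStrategy

  attacks? : ∀ x y → Dec (Attacks x y)
  attacks? x y = combine x y ∈? Att

  record AdmissibleSet (S : Subset n) : Set where
    field
      a∈S          : a ∈ S
      conflictFree : ∀ x y → x ∈ S → y ∈ S → ¬ Attacks x y
      defended     : ∀ x y → y ∈ S → Attacks x y → ∃[ z ] (z ∈ S × Attacks z x)

  admissibleSet? : Decidable AdmissibleSet
  admissibleSet? S =
    map′ (λ (a∈ , cf , d) → record { a∈S = a∈ ; conflictFree = cf ; defended = d })
         (λ A → let open AdmissibleSet A in a∈S , conflictFree , defended)
         ( a ∈? S
     ×-dec all? (λ x → all? λ y → x ∈? S →-dec y ∈? S →-dec ¬? (attacks? x y))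
     ×-dec all? (λ x → all? λ y → y ∈? S →-dec attacks? x y →-dec
                   any? λ z → z ∈? S ×-dec attacks? z x))

  module _ {S : Subset n} (admissible : AdmissibleSet S) where
    open AdmissibleSet admissible

    defender? : ∀ i → Dec (∃[ z ] (z ∈ S × Attacks z i))
    defender? i = any? λ z → z ∈? S ×-dec attacks? z i

    defend : Fin n → Maybe (Fin n)
    defend i with defender? i
    ... | yes (z , _) = just z
    ... | no _        = nothing

    defend-just : ∀ {z i} → defend i ≡ just z → z ∈ S × Attacks z i
    defend-just {i = i} eq with defender? i
    defend-just refl | yes (_ , z∈S , zi) = z∈S , zi

    defend-defined : ∀ {i} → ∃[ z ] (z ∈ S × Attacks z i) → ∃[ z ] defend i ≡ just z
    defend-defined {i} z with defender? i
    ... | yes (z′ , _) = z′ , refl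
    ... | no ∄z        = contradiction z ∄z

    defence : TreeStrategy
    defence = mkTreeStrategy defend (proj₂ ∘ defend-just)

    proNode∈S : ∀ {x} {ν : Node Pro x} → ν ∈T[ defence ] → x ∈ S
    proNode∈S root∈         = a∈S
    proNode∈S (opp∈ _ _ eq) = proj₁ (defend-just eq)

    oppNode-attacks-S : ∀ {x} {ν : Node Opp x} → ν ∈T[ defence ] → ∃[ y ] (y ∈ S × Attacks x y)
    oppNode-attacks-S (pro∈ ν∈ xy) = _ , proNode∈S ν∈ , xy

    -- Proponent nodes carry elements of `S` and opponent nodes carry attackers of `S`. Hence the
    -- latter are always answered from `S`, and an argument labelled twice would be an element of
    -- `S` attacking `S`.
    defence-admissible : IsAdmissibleWinning defence
    defence-admissible = record
      { opponentAnswered = answered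
      ; conflictFree     = λ x ((_ , μ∈) , (_ , ν∈)) →
          let y , y∈S , xy = oppNode-attacks-S ν∈
          in conflictFree x y (proNode∈S μ∈) y∈S xy
      }
      where
      answered : ∀ {i} (ν : Node Opp i) → ν ∈T[ defence ] → HasOneChild defence ν
      answered {i} ν ν∈ =
        let y , y∈S , iy = oppNode-attacks-S ν∈
            z , eq       = defend-defined (defended i y y∈S iy)
            zi           = proj₂ (defend-just eq)
        in (z , zi) , opp∈ ν∈ zi eq , unique eq zi
        where
        unique : ∀ {z} → defend i ≡ just z → (zi : Attacks z i) →
                 ∀ {child} → childOfOpp ν (proj₂ child) ∈T[ defence ] → (z , zi) ≡ child
        unique eq zi (opp∈ _ zi′ eq′) with trans (sym eq) eq′
        -- Since `defend` is a function the two attackers agree, and membership proofs are unique.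
        ... | refl = cong (_ ,_) ([]=-irrelevant zi zi′)

-- Strategies and single moves in the interpreted system

module Plays (AF : Framework n) (a : Fin n) where
  open Framework AF
  open AdmissibleSets AF a using (attacks?)
  open InterpretedSystem AF a
  open State
  open EnvState
  open PlayerStrategy

  Turn : State → Player → Fin n → Set
  Turn g i y = turn (envLocal g) ≡ i × last (envLocal g) ≡ y

  anyStrategy : ∀ i → PlayerStrategy i
  anyStrategy i = mkStrategy (λ _ s → proj₁ (choice s)) (λ _ s → proj₂ (choice s))
    where
    choice : ∀ s → ∃ (Enabled i s)
    choice (envState t y S S⊆) with (t ≟ᴾ i) ×-dec any? (λ x → attacks? x y)
    ... | yes (refl , _ , xy) = _ , attackEnabled xy
    ... | no ¬xy              = _ , idleEnabled ¬xy

  Preference : Set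
  Preference = ∀ y → Maybe (∃[ x ] Attacks x y)

  -- Follows `m` where it is defined and `f` elsewhere. This serves both for Pro playing by a tree
  -- strategy and for Opp deviating at a single argument.
  prefer : ∀ {i} → Preference → PlayerStrategy i → PlayerStrategy i
  prefer {i} m f = mkStrategy (λ l s → proj₁ (choice l s)) (λ l s → proj₂ (choice l s))
    where
    choice : ∀ l s → ∃ (Enabled i s)
    choice l s@(envState t y _ _) with t ≟ᴾ i | m y
    ... | yes refl | just (_ , xy) = _ , attackEnabled xy
    ... | yes _    | nothing       = act f l s , enabled f l s
    ... | no _     | _             = act f l s , enabled f l s

  module _ {i} (m : Preference) (f : PlayerStrategy i) (l : Local (player i)) where

    prefer-just : ∀ s {x xy} → turn s ≡ i → m (last s) ≡ just (x , xy) →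
                  act (prefer m f) l s ≡ attack x (last s) xy
    prefer-just (envState _ y _ _) refl eq with i ≟ᴾ i | m y
    prefer-just _ refl refl | yes refl | just _ = refl
    prefer-just _ refl _    | no i≢i   | _      = contradiction refl i≢i

    prefer-nothing : ∀ s → m (last s) ≡ nothing → act (prefer m f) l s ≡ act f l s
    prefer-nothing (envState t y _ _) eq with t ≟ᴾ i | m y
    prefer-nothing _ _ | yes refl | nothing = refl
    prefer-nothing _ _ | no _     | _       = refl

    prefer-otherTurn : ∀ s → turn s ≢ i → act (prefer m f) l s ≡ act f l s
    prefer-otherTurn (envState t y _ _) t≢i with t ≟ᴾ i | m y
    ... | yes t≡i | _ = contradiction t≡i t≢i
    ... | no _    | _ = refl

  module _ (fₚ : PlayerStrategy Pro) (fₒ : PlayerStrategy Opp) (fₑ : Strategy Env) where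

    -- The protocol forces Opp to idle, so either Pro attacks or Pro has no attack and the state is
    -- fixed. Atoms ignore the assignment, so `∅` can stand for any.
    proMoves : ∀ g {y} → Turn g Pro y → let g′ = next fₚ fₒ fₑ g in
      (Σ[ x ∈ Fin n ] Σ[ xy ∈ Attacks x y ]
         act fₚ (proLocal g) (envLocal g) ≡ attack x y xy × (∅ , g′ ⊨ pro x))
      ⊎ (¬ (∃[ x ] Attacks x y) × g′ ≡ g)
    proMoves ⟪ l , m , s@(envState Pro y _ _) ⟫ (refl , refl)
      with act fₚ l s | enabled fₚ l s | act fₒ m s | enabled fₒ m s | fₑ s
    ... | idle | idleEnabled ¬xy | idle | idleEnabled _ | idle =
      inj₂ ((λ xy → ¬xy (refl , xy)) , refl)
    ... | attack x _ xy | attackEnabled _ | idle | idleEnabled _ | idle with y ≟ y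
    ...   | yes _  = inj₁ (x , xy , refl , refl , refl , refl)
    ...   | no y≢y = contradiction refl y≢y

    oppMoves : ∀ g {y} → Turn g Opp y → let g′ = next fₚ fₒ fₑ g in
      (Σ[ x ∈ Fin n ] Σ[ xy ∈ Attacks x y ]
         act fₒ (oppLocal g) (envLocal g) ≡ attack x y xy × (∅ , g′ ⊨ opp x))
      ⊎ (¬ (∃[ x ] Attacks x y) × g′ ≡ g)
    oppMoves ⟪ l , m , s@(envState Opp y _ _) ⟫ (refl , refl)
      with act fₚ l s | enabled fₚ l s | act fₒ m s | enabled fₒ m s | fₑ s
    ... | idle | idleEnabled _ | idle | idleEnabled ¬xy | idle =
      inj₂ ((λ xy → ¬xy (refl , xy)) , refl)
    ... | idle | idleEnabled _ | attack x _ xy | attackEnabled _ | idle with y ≟ y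
    ...   | yes _  = inj₁ (x , xy , refl , refl , refl , refl)
    ...   | no y≢y = contradiction refl y≢y

  path-fixed : ∀ {f g} → f g ≡ g → ∀ k → path f g k ≡ g
  path-fixed         _     zero    = refl
  path-fixed {f} {g} fixed (suc k) = trans (cong f (path-fixed fixed k)) fixed

-- From an admissible winning strategy to the formula

module Soundness (AF : Framework n) (a : Fin n)
                 (σ : DisputeTree.TreeStrategy AF a)
                 (winning : DisputeTree.IsAdmissibleWinning AF a σ) where
  open Framework AF
  open DisputeTree AF a
  open InterpretedSystem AF a
  open Plays AF a
  open TreeStrategy σ
  open IsAdmissibleWinning winning
  open State
  open EnvState
  open PlayerStrategy

  -- The value of `move y` is passed along with its equation, because `attacks` needs that equation
  -- to produce the attack.
  withAttack : ∀ {y} (mx : Maybe (Fin n)) → move y ≡ mx → Maybe (∃[ x ] Attacks x y)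
  withAttack (just x) eq = just (x , attacks eq)
  withAttack nothing  _  = nothing

  σ-preference : Preference
  σ-preference y = withAttack (move y) refl

  σ-preference-just : ∀ {x y} → move y ≡ just x → ∃[ xy ] σ-preference y ≡ just (x , xy)
  σ-preference-just {x} {y} = lemma (move y) refl
    where
    lemma : ∀ mx (eq : move y ≡ mx) → mx ≡ just x → ∃[ xy ] withAttack mx eq ≡ just (x , xy)
    lemma (just _) eq refl = attacks eq , refl

  σ-strategy : PlayerStrategy Pro
  σ-strategy = prefer σ-preference (anyStrategy Pro)

  -- The last argument was put forward by the player whose turn it is not; initially this gives Pro,
  -- the label of the root.
  lastMover : Player → Player
  lastMover Pro = Opp
  lastMover Opp = Pro

  InTree : State → Set
  InTree g = Labelled σ (lastMover (turn (envLocal g))) (last (envLocal g))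

  answer : ∀ {i} → Labelled σ Opp i → ∃[ x ] (move i ≡ just x × Labelled σ Pro x)
  answer (ν , ν∈) with opponentAnswered ν ν∈
  ... | (x , _) , child∈@(opp∈ _ _ eq) , _ = x , eq , _ , child∈

  pro-labelled : ∀ g {x} → InTree g → ∅ , g ⊨ pro x → Labelled σ Pro x
  pro-labelled _ t (_ , refl , refl) = t

  opp-labelled : ∀ g {x} → InTree g → ∅ , g ⊨ opp x → Labelled σ Opp x
  opp-labelled _ t (_ , refl , refl) = t

  pro-inTree : ∀ g {x} → Labelled σ Pro x → ∅ , g ⊨ pro x → InTree g
  pro-inTree _ t (_ , refl , refl) = t

  opp-inTree : ∀ g {x} → Labelled σ Opp x → ∅ , g ⊨ opp x → InTree g
  opp-inTree _ t (_ , refl , refl) = t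

  module _ (fₒ : PlayerStrategy Opp) (fₑ : Strategy Env) where

    -- By `opponentAnswered`, `σ` is defined at `i`, so `σ-strategy` plays that move and never its
    -- fallback.
    proAnswers : ∀ g {i} → Turn g Pro i → Labelled σ Opp i →
                 ∃[ x ] (Labelled σ Pro x × (∅ , next σ-strategy fₒ fₑ g ⊨ pro x))
    proAnswers g@(⟪ l , _ , s ⟫) turn@(refl , refl) i∈ with answer i∈
    ... | x , eq , x∈ with σ-preference-just eq
    ...   | xi , pref with proMoves σ-strategy fₒ fₑ g turn
    ...     | inj₂ (∄x , _) = contradiction (x , xi) ∄x
    ...     | inj₁ (_ , _ , acts , isPro)
                with trans (sym acts) (prefer-just σ-preference (anyStrategy Pro) l s refl pref)
    ...       | refl = x , x∈ , isPro

    next-inTree : ∀ g → InTree g → InTree (next σ-strategy fₒ fₑ g)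
    next-inTree g@(⟪ _ , _ , envState Pro i _ _ ⟫) t =
      let _ , x∈ , isPro = proAnswers g (refl , refl) t
      in pro-inTree (next σ-strategy fₒ fₑ g) x∈ isPro
    next-inTree g@(⟪ _ , _ , envState Opp y _ _ ⟫) t@(ν , ν∈)
      with oppMoves σ-strategy fₒ fₑ g (refl , refl)
    ... | inj₁ (_ , xy , _ , isOpp) = opp-inTree (next σ-strategy fₒ fₑ g) (_ , pro∈ ν∈ xy) isOpp
    -- Opp has no attacker to put forward: the branch ends at a proponent leaf and the play stays
    -- there.
    ... | inj₂ (_ , fixed)          = subst InTree (sym fixed) t

    path-inTree : ∀ k → InTree (path (next σ-strategy fₒ fₑ) s₀ k)
    path-inTree zero    = root , root∈
    path-inTree (suc k) = next-inTree _ (path-inTree k)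

  satisfied : IS⊨ ∃′ p (∀′ e (∀′ o (G (⋀ λ i → ∼ G (opp i)))
                 ∧′ (⋀ λ i → ∃′ o (F (pro i)) ⇒′ ∀′ o (G (∼ opp i)))))
  -- As `∀′` abbreviates not-exists-not, each universal claim is proved by refuting a
  -- counterexample.
  satisfied = σ-strategy , λ (fₑ , refuted) → refuted
    ( (λ (fₒ , stuck) → stuck (_ , refl , λ { k i (_ , refl , always) →
        -- Two consecutive states suffice: Pro's answer passes the turn to Opp, which falsifies
        -- `opp i`.
        oppNotForever fₒ fₑ _ (path-inTree fₒ fₑ k) (always 0) (always 1) }))
    , (λ { i (fₒ , _ , refl , k , isPro) (fₒ′ , attained) →
        attained (_ , refl , λ k′ isOpp → conflictFree i
          ( pro-labelled (path (next σ-strategy fₒ fₑ) s₀ k) (path-inTree fₒ fₑ k) isPro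
          , opp-labelled (path (next σ-strategy fₒ′ fₑ) s₀ k′) (path-inTree fₒ′ fₑ k′) isOpp)) }))
    where
    oppNotForever : ∀ fₒ fₑ g {i} → InTree g → ∅ , g ⊨ opp i →
                    ¬ (∅ , next σ-strategy fₒ fₑ g ⊨ opp i)
    oppNotForever fₒ fₑ g t isOpp@(_ , turn) (_ , isProTurn , _)
      with proAnswers fₒ fₑ g turn (opp-labelled g t isOpp)
    ... | _ , _ , _ , isOppTurn , _ = contradiction (trans (sym isProTurn) isOppTurn) λ ()

-- From the formula to an admissible set

module Completeness (AF : Framework n) (a : Fin n)
                    (fₚ : InterpretedSystem.PlayerStrategy AF a Pro) where
  open Framework AF
  open AdmissibleSets AF a
  open InterpretedSystem AF a
  open Plays AF a
  open State
  open EnvState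
  open PlayerStrategy

  fₑ : Strategy Env
  fₑ _ = idle

  run : PlayerStrategy Opp → ℕ → State
  run fₒ = path (next fₚ fₒ fₑ) s₀

  -- With Pro's strategy fixed to `fₚ`, this is the meaning of `∃′ o (F (pro i))`, and likewise for
  -- `opp i`.
  Attained : Player → Fin n → Set
  Attained Pro i = ∃[ fₒ ] ∃[ k ] ∅ , run fₒ k ⊨ pro i
  Attained Opp i = ∃[ fₒ ] ∃[ k ] ∅ , run fₒ k ⊨ opp i

  module Deviation (fₒ : PlayerStrategy Opp) {x y} (xy : Attacks x y) where

    answer-y : Preference
    answer-y y′ with y ≟ y′
    ... | yes refl = just (x , xy)
    ... | no _     = nothing

    answer-y-just : answer-y y ≡ just (x , xy)
    answer-y-just with y ≟ y
    ... | yes refl = refl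
    ... | no y≢y   = contradiction refl y≢y

    answer-y-nothing : ∀ {y′} → y ≢ y′ → answer-y y′ ≡ nothing
    answer-y-nothing {y′} y≢y′ with y ≟ y′
    ... | yes y≡y′ = contradiction y≡y′ y≢y′
    ... | no _     = refl

    deviation : PlayerStrategy Opp
    deviation = prefer answer-y fₒ

    next-deviation : ∀ g → Turn g Opp y ⊎ next fₚ deviation fₑ g ≡ next fₚ fₒ fₑ g
    next-deviation g = compare (turn s ≟ᴾ Opp) (y ≟ last s)
      where
      l = oppLocal g
      s = envLocal g

      next-agrees : act deviation l s ≡ act fₒ l s →
                    next fₚ deviation fₑ g ≡ next fₚ fₒ fₑ g
      next-agrees = cong (λ c → step g s (act fₚ (proLocal g) s) c idle)

      compare : Dec (turn s ≡ Opp) → Dec (y ≡ last s) →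
                Turn g Opp y ⊎ next fₚ deviation fₑ g ≡ next fₚ fₒ fₑ g
      compare (yes t≡Opp) (yes y≡last) = inj₁ (t≡Opp , sym y≡last)
      compare (no t≢Opp)  _            =
        inj₂ (next-agrees (prefer-otherTurn answer-y fₒ l s t≢Opp))
      compare (yes _)     (no y≢last)  =
        inj₂ (next-agrees (prefer-nothing answer-y fₒ l s (answer-y-nothing y≢last)))

    -- The two strategies can act differently only when Opp has to answer `y`, so a disagreement
    -- between the runs is itself evidence that the deviating run has reached `y`.
    run-deviation : ∀ k → (∃[ j ] Turn (run deviation j) Opp y) ⊎ run deviation k ≡ run fₒ k
    run-deviation zero = inj₂ refl
    run-deviation (suc k) with run-deviation k
    ... | inj₁ reached = inj₁ reached
    ... | inj₂ same with next-deviation (run deviation k)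
    ...   | inj₁ yTurn = inj₁ (k , yTurn)
    ...   | inj₂ same′ = inj₂ (trans same′ (cong (next fₚ fₒ fₑ) same))

    reaches-y : ∀ k → Turn (run fₒ k) Opp y → ∃[ j ] Turn (run deviation j) Opp y
    reaches-y k yTurn with run-deviation k
    ... | inj₁ reached = reached
    ... | inj₂ same    = k , subst (λ g → Turn g Opp y) (sym same) yTurn

    attacks-y : ∀ g → Turn g Opp y → ∅ , next fₚ deviation fₑ g ⊨ opp x
    attacks-y g@(⟪ _ , m , s@(envState _ _ _ _) ⟫) yTurn@(refl , refl)
      with oppMoves fₚ deviation fₑ g yTurn
    ... | inj₂ (∄x , _) = contradiction (x , xy) ∄x
    ... | inj₁ (_ , _ , acts , isOpp)
            with trans (sym acts) (prefer-just answer-y fₒ m s refl answer-y-just)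
    ...   | refl = isOpp

    reaches-x : ∀ k → Turn (run fₒ k) Opp y → ∃[ j ] ∅ , run deviation j ⊨ opp x
    reaches-x k yTurn = let j , yTurn′ = reaches-y k yTurn in suc j , attacks-y _ yTurn′

  attacker-attained : ∀ {x y} → Attained Pro y → Attacks x y → Attained Opp x
  attacker-attained (fₒ , k , _ , yTurn) xy = deviation , reaches-x k yTurn
    where open Deviation fₒ xy

  module _ (neverStuck : ∀ fₒ k i → ¬ (∀ j → ∅ , path (next fₚ fₒ fₑ) (run fₒ k) j ⊨ opp i))
           (disjoint : ∀ i → Attained Pro i → ¬ Attained Opp i) where

    -- If Pro had no attack on `i`, the state would never change again and `opp i` would hold
    -- forever, contrary to `neverStuck`.
    answer-attained : ∀ {i} → Attained Opp i → ∃[ z ] (Attained Pro z × Attacks z i)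
    answer-attained {i} (fₒ , k , isOpp@(_ , iTurn)) with proMoves fₚ fₒ fₑ (run fₒ k) iTurn
    ... | inj₁ (z , zi , _ , isPro) = z , (fₒ , suc k , isPro) , zi
    ... | inj₂ (_ , fixed) = contradiction
      (λ j → subst (λ g → ∅ , g ⊨ opp i) (sym (path-fixed fixed j)) isOpp)
      (neverStuck fₒ k i)

    attained-admissible : (attained? : Decidable (Attained Pro)) →
                          AdmissibleSet (comprehension attained?)
    attained-admissible attained? = record
      -- At time 0 the initial state satisfies `pro a`, whatever Opp plays.
      { a∈S          = ∈⁺ (anyStrategy Opp , 0 , refl , refl , refl)
      ; conflictFree = λ x y x∈ y∈ xy → disjoint x (∈⁻ x∈) (attacker-attained (∈⁻ y∈) xy)
      ; defended     = λ x y y∈ xy →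
          let z , z-attained , zx = answer-attained (attacker-attained (∈⁻ y∈) xy)
          in z , ∈⁺ z-attained , zx
      }
      where
      ∈⁺ = comprehension⁺ attained?
      ∈⁻ = comprehension⁻ attained?

  ∃-admissibleSet :
    (∅ [ p ↦ fₚ ]) , s₀ ⊨ ∀′ e (∀′ o (G (⋀ λ i → ∼ G (opp i)))
                            ∧′ (⋀ λ i → ∃′ o (F (pro i)) ⇒′ ∀′ o (G (∼ opp i)))) →
    ∃ AdmissibleSet
  -- Stability turns the goal into a contradiction, so the doubly negated decidability of
  -- `Attained Pro` and the negated universal formulas can be used.
  ∃-admissibleSet sat = decidable-stable (anySubset? admissibleSet?) λ ∄S →
    ¬¬-decidable (Attained Pro) λ attained? →
    sat (fₑ , λ (φ₁ , φ₂) → ∄S (_ , attained-admissible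
      -- The inner `G` restarts the play at `run fₒ k`, which is the path that `neverStuck` speaks
      -- of.
      (λ fₒ k i always → φ₁ (fₒ , λ { (_ , refl , holds) → holds k i (_ , refl , always) }))
      (λ { i (fₒ , k , isPro) (fₒ′ , k′ , isOpp) →
         φ₂ i (fₒ , _ , refl , k , isPro)
              (fₒ′ , λ { (_ , refl , holds) → holds k′ isOpp }) })
      attained?))

theorem4p2 :
    (n : ℕ) (AF : Framework n) (a : Fin n) →
    let open DisputeTree AF a using (IsAdmissibleWinning)
        open InterpretedSystem AF a using (IS⊨_)
        φ₁ = ∀′ o (G (⋀ λ i → ∼ G (opp i)))
        φ₂ = ⋀ λ i → ∃′ o (F (pro i)) ⇒′ ∀′ o (G (∼ opp i))
    in
    ∃ IsAdmissibleWinning ⇔ (IS⊨ ∃′ p (∀′ e (φ₁ ∧′ φ₂)))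
theorem4p2 n AF a = mk⇔
  (λ (σ , winning) → Soundness.satisfied AF a σ winning)
  (λ (fₚ , sat) → let _ , admissible = Completeness.∃-admissibleSet AF a fₚ sat
                  in defence admissible , defence-admissible admissible)
  where open AdmissibleSets AF a
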